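{- Let $\alpha=(\mathcal{F}_{i+1})_{i\geqslant 0}=(1,1,2,3,5,8,\ldots)$ and $\tilde{\alpha}=((-1)^i\mathcal{F}_{i+1})_{i\geqslant 0}$, so that the binomial transforms are $\check{\alpha}=(\mathcal{F}_{2i+1})_{i\geqslant 0}=(1,2,5,13,34,\ldots)$ and $\check{\tilde{\alpha}}=(\mathcal{F}_{i-1})_{i\geqslant 0}=(1,0,1,1,2,3,5,\ldots)$. Then the infinite integer matrices $T_{\tilde{\alpha},\alpha}$, $T_{\alpha,\tilde{\alpha}}$, $P_{\check{\tilde{\alpha}},\check{\alpha}}$, $P_{\check{\alpha},\check{\tilde{\alpha}}}$, $A_{\check{\tilde{\alpha}},\alpha}$ and $A_{\check{\alpha},\tilde{\alpha}}$ are equimodular. More precisely, for all integers $n\geqslant 0$, $$\det T_{\tilde{\alpha},\alpha}(n)=\det T_{\alpha,\tilde{\alpha}}(n)=\det P_{\check{\tilde{\alpha}},\check{\alpha}}(n)=\det P_{\check{\alpha},\check{\tilde{\alpha}}}(n)=\det A_{\check{\tilde{\alpha}},\alpha}(n)=\det A_{\check{\alpha},\tilde{\alpha}}(n)=\mathcal{F}_{n+2}.$$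
   Context: $\mathcal{F}_n$ is the $n$th Fibonacci number: $\mathcal{F}_0=0$, $\mathcal{F}_1=1$, $\mathcal{F}_n=\mathcal{F}_{n-1}+\mathcal{F}_{n-2}$ for $n\geqslant 2$, with $\mathcal{F}_{ -1}=1$. For a sequence $\omega=(\omega_i)_{i\geqslant 0}$, $\check{\omega}=(\check{\omega}_i)_{i\geqslant 0}$ is defined by $\check{\omega}_i=\sum_{k=0}^{i}\binom{i}{k}\omega_k$. Let $\alpha,\beta$ be sequences with $\alpha_0=\beta_0$. The following are square matrices of order $n+1$, indexed from $(0,0)$, each with first column given by $\alpha$ and first row given by $\beta$ (i.e. $(i,0)$-entry $\alpha_i$ and $(0,i)$-entry $\beta_i$ for $0\leqslant i\leqslant n$): $T_{\alpha,\beta}(n)=[T_{i,j}]$ is the Toeplitz matrix, with $T_{i,j}=T_{k,l}$ whenever $i-j=k-l$; $P_{\alpha,\beta}(n)=[P_{i,j}]$ is the generalized Pascal triangle, with $P_{i,j}=P_{i,j-1}+P_{i-1,j}$ for $1\leqslant i,j\leqslant n$; $A_{\alpha,\beta}(n)=[A_{i,j}]$ is the 7-matrix, with $A_{i,j}=A_{i-1,j-1}+A_{i-1,j}$ for $1\leqslant i,j\leqslant n$. $T_{\alpha,\beta}$, $P_{\alpha,\beta}$, $A_{\alpha,\beta}$ denote the corresponding infinite matrices. Two infinite matrices $[A_{i,j}]_{i,j\geqslant 0}$ and $[B_{i,j}]_{i,j\geqslant 0}$ are equimodular if $\det[A_{i,j}]_{0\leqslant i,j\leqslant n}=\det[B_{i,j}]_{0\leqslant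 i,j\leqslant n}$ for all $n\geqslant 0$. -}

module Defs where

open import Data.Nat.Base as ℕ using (ℕ; zero; suc)
import Data.Nat.Properties as ℕ
open import Data.Nat.Combinatorics using (_C_)
open import Data.Integer.Base using (ℤ; +_; _+_; _*_; _^_; 1ℤ; -1ℤ)
open import Data.Integer.Properties using (+-0-commutativeMonoid)
open import Data.Fin.Base using (Fin; zero; suc; toℕ; punchIn)
open import Algebra.Properties.CommutativeMonoid.Sum +-0-commutativeMonoid
  using (sum-syntax; sum⁺-syntax)
open import Relation.Binary.PropositionalEquality

Sequence : Set
Sequence = ℕ → ℤ

Matrix∞ : Set
Matrix∞ = ℕ → ℕ → ℤ

SquareMatrix : ℕ → Set
SquareMatrix m = Fin m → Fin m → ℤ

-- Laplace expansion along the first row; punchIn j skips column j.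
det : ∀ {m} → SquareMatrix m → ℤ
det {zero}  M = 1ℤ
det {suc m} M =
  ∑[ j < suc m ] (-1ℤ ^ toℕ j * M zero j * det (λ i k → M (suc i) (punchIn j k)))

-- The block with indices 0, …, n, so of order n + 1.
leading : ∀ n → Matrix∞ → SquareMatrix (suc n)
leading n M i j = M (toℕ i) (toℕ j)

Equimodular : Matrix∞ → Matrix∞ → Set
Equimodular M N = ∀ n → det (leading n M) ≡ det (leading n N)

binomialTransform : Sequence → Sequence
binomialTransform ω i = ∑[ k ≤ i ] (+ (i C toℕ k) * ω (toℕ k))

-- In the following three matrices the first argument is the first column and
-- the second is the first row. They are intended for α 0 ≡ β 0; the corner
-- entry is read off from β.

toeplitz : Sequence → Sequence → Matrix∞
toeplitz α β zero    j       = β j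
toeplitz α β (suc i) zero    = α (suc i)
toeplitz α β (suc i) (suc j) = toeplitz α β i j

pascal : Sequence → Sequence → Matrix∞
pascal α β zero    j       = β j
pascal α β (suc i) zero    = α (suc i)
pascal α β (suc i) (suc j) = pascal α β (suc i) j + pascal α β i (suc j)

sevenMatrix : Sequence → Sequence → Matrix∞
sevenMatrix α β zero    j       = β j
sevenMatrix α β (suc i) zero    = α (suc i)
sevenMatrix α β (suc i) (suc j) = sevenMatrix α β i j + sevenMatrix α β i (suc j)

toeplitz-column : ∀ α β → α 0 ≡ β 0 → ∀ i → toeplitz α β i 0 ≡ α i
toeplitz-column α β eq zero    = sym eq
toeplitz-column α β eq (suc i) = refl

pascal-column : ∀ α β → α 0 ≡ β 0 → ∀ i → pascal α β i 0 ≡ α i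
pascal-column α β eq zero    = sym eq
pascal-column α β eq (suc i) = refl

sevenMatrix-column : ∀ α β → α 0 ≡ β 0 → ∀ i → sevenMatrix α β i 0 ≡ α i
sevenMatrix-column α β eq zero    = sym eq
sevenMatrix-column α β eq (suc i) = refl

-- The hypothesis is i - j = k - l, written without subtraction.
toeplitz-diagonal : ∀ α β i j k l → i ℕ.+ l ≡ k ℕ.+ j →
                    toeplitz α β i j ≡ toeplitz α β k l
toeplitz-diagonal α β (suc i) (suc j) k l eq =
  toeplitz-diagonal α β i j k l
    (ℕ.suc-injective (trans eq (ℕ.+-suc k j)))
toeplitz-diagonal α β zero j zero l eq = cong β (sym eq)
toeplitz-diagonal α β zero j (suc k) (suc l) eq =
  toeplitz-diagonal α β zero j k l (ℕ.suc-injective eq)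
toeplitz-diagonal α β (suc i) zero (suc k) zero eq =
  cong α (ℕ.+-cancelʳ-≡ 0 (suc i) (suc k) eq)
toeplitz-diagonal α β (suc i) zero (suc k) (suc l) eq =
  toeplitz-diagonal α β (suc i) zero k l
    (ℕ.suc-injective (trans (sym (ℕ.+-suc (suc i) l)) eq))

fib : ℕ → ℤ
fib zero          = + 0
fib (suc zero)    = + 1
fib (suc (suc n)) = fib (suc n) + fib n

-- The Fibonacci number of index i - 1, the one of index -1 being 1.
fibPred : ℕ → ℤ
fibPred zero    = + 1
fibPred (suc i) = fib i

α : Sequence
α i = fib (1 ℕ.+ i)

α~ : Sequence
α~ i = -1ℤ ^ i * fib (1 ℕ.+ i)

check-α : Sequence
check-α = binomialTransform α

check-α~ : Sequence
check-α~ = binomialTransform α~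

{-# OPTIONS --safe #-}
module Submission where

-- Let B be the lower unitriangular matrix of binomial coefficients. Then
-- A_{ǎ,b} = B T_{a,b} and P_{ǎ,b̌} = A_{ǎ,b} Bᵗ have the same leading minors as
-- T_{a,b}, and T_{b,a} is the transpose of T_{a,b}. With F extended to negative
-- indices, the entry of T_{α̃,α} in position (i, i + k) is F_{k+1} for k ≥ 0 and
-- F_{k-1} for k ≤ 0. So, when its two predecessors are subtracted from every
-- column, the first row becomes (1, 0, …, 0), and the complementary minor
-- becomes a column followed by the first columns of the identity matrix; the
-- last entry of that column is ± F_{n+2}.

open import Data.Product.Base using (_×_; _,_; proj₁; proj₂)
open import Relation.Binary.PropositionalEquality
open import Defs

module Determinants where

  open import Data.Fin.Base as Fin using (Fin; zero; suc; toℕ; punchIn; lift)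
  import Data.Fin.Properties as Fin
  open import Data.Integer.Base as ℤ using (ℤ; _+_; _*_; _-_; _^_; 0ℤ; 1ℤ; -1ℤ)
  open import Data.Integer.Properties
    using (+-*-semiring; +-0-abelianGroup; +-identityˡ; +-identityʳ; +-comm; +-assoc;
           *-identityˡ; *-zeroʳ; pos-+)
  open import Data.Integer.Tactic.RingSolver using (solve-∀)
  open import Data.Nat.Base as ℕ using (ℕ; zero; suc; z≤n; s≤s)
  open import Data.Nat.Combinatorics
    using (_C_; nCn≡1; k>n⇒nCk≡0; nCk+nC[k+1]≡[n+1]C[k+1])
  import Data.Nat.Properties as ℕ
  import Data.Nat.Tactic.RingSolver as ℕSolver
  open import Data.Vec.Functional using (Vector; _∷_; tail)
  open import Function.Base using (_∘_)
  open import Algebra.Bundles using (module AbelianGroup)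
  open import Algebra.Properties.Group (AbelianGroup.group +-0-abelianGroup)
    using () renaming (∙-cancelʳ to +-cancelʳ)
  open import Algebra.Properties.Semiring.Sum +-*-semiring
    using (sum; sum-syntax; sum⁺-syntax; sum-cong-≗; sum-replicate-zero; ∑-distrib-+;
           ∑-comm; *-distribˡ-sum)
  open ≡-Reasoning

  -- Finite sums; Laplace expansion along a row and along a column.

  sum-zero : ∀ {m} {f : Vector ℤ m} → (∀ i → f i ≡ 0ℤ) → sum f ≡ 0ℤ
  sum-zero {m} f≡0 = trans (sum-cong-≗ f≡0) (sum-replicate-zero m)

  sum-linear : ∀ {m} c (f g : Vector ℤ m) →
               ∑[ i < m ] (f i + c * g i) ≡ sum f + c * sum g
  sum-linear c f g =
    trans (∑-distrib-+ f (λ i → c * g i)) (cong (sum f +_) (sym (*-distribˡ-sum c g)))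

  transpose : ∀ {m} → SquareMatrix m → SquareMatrix m
  transpose M i j = M j i

  det-cong : ∀ {m} (M N : SquareMatrix m) → (∀ i j → M i j ≡ N i j) → det M ≡ det N
  det-cong {zero}  M N M≡N = refl
  det-cong {suc m} M N M≡N = sum-cong-≗ λ j →
    cong₂ (λ a d → -1ℤ ^ toℕ j * a * d) (M≡N zero j)
      (det-cong (λ i k → M (suc i) (punchIn j k)) (λ i k → N (suc i) (punchIn j k))
        λ i k → M≡N (suc i) (punchIn j k))

  -- Both expansions share the term of the corner entry. In every other term of the row expansion
  -- the minor still starts with entries of column 0, so by induction it is expanded along that
  -- column. After the two sums are exchanged, the inner one is the row expansion of a minor without
  -- column 0.
  det-laplace-column : ∀ {m} (M : SquareMatrix (suc m)) →
    det M ≡ ∑[ i < suc m ] (-1ℤ ^ toℕ i * M i zero * det (λ k l → M (punchIn i k) (suc l)))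
  det-laplace-column {zero}  M = refl
  det-laplace-column {suc m} M = cong (1ℤ * M zero zero * det (λ k l → M (suc k) (suc l)) +_) (begin
    ∑[ j < suc m ] (-1ℤ * ε j * M zero (suc j) * det (λ i k → M (suc i) (punchIn (suc j) k)))
      ≡⟨ sum-cong-≗ (λ j → trans
           (cong (-1ℤ * ε j * M zero (suc j) *_)
             (det-laplace-column (λ i k → M (suc i) (punchIn (suc j) k))))
           (*-distribˡ-sum (-1ℤ * ε j * M zero (suc j)) (λ i → ε i * M (suc i) zero * minor i j))) ⟩
    ∑[ j < suc m ] ∑[ i < suc m ] (-1ℤ * ε j * M zero (suc j) * (ε i * M (suc i) zero * minor i j))
      ≡⟨ ∑-comm (λ j i → -1ℤ * ε j * M zero (suc j) * (ε i * M (suc i) zero * minor i j)) ⟩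
    ∑[ i < suc m ] ∑[ j < suc m ] (-1ℤ * ε j * M zero (suc j) * (ε i * M (suc i) zero * minor i j))
      ≡⟨ sum-cong-≗ (λ i → trans
           (sum-cong-≗ λ j → rearrange -1ℤ (ε j) (M zero (suc j)) (ε i) (M (suc i) zero) (minor i j))
           (sym (*-distribˡ-sum (-1ℤ * ε i * M (suc i) zero) (λ j → ε j * M zero (suc j) * minor i j)))) ⟩
    ∑[ i < suc m ] (-1ℤ * ε i * M (suc i) zero * det (λ k l → M (punchIn (suc i) k) (suc l))) ∎)
    where
    ε : ∀ {n} → Fin n → ℤ
    ε i = -1ℤ ^ toℕ i
    minor : Fin (suc m) → Fin (suc m) → ℤ
    minor i j = det (λ k l → M (suc (punchIn i k)) (suc (punchIn j l)))
    rearrange : ∀ a b c d e f → a * b * c * (d * e * f) ≡ a * d * e * (b * c * f)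
    rearrange = solve-∀

  det-transpose : ∀ {m} (M : SquareMatrix m) → det (transpose M) ≡ det M
  det-transpose {zero}  M = refl
  det-transpose {suc m} M = trans
    (sum-cong-≗ λ j → cong (-1ℤ ^ toℕ j * M j zero *_)
      (det-transpose (λ k l → M (punchIn j k) (suc l))))
    (sym (det-laplace-column M))

  -- The determinant alternates in its first two rows.

  -- `S j k` is meant as a term for the ordered pair of distinct columns `j` and `punchIn j k`. The
  -- pairs with column 0 in first place and those with column 0 in second place cancel by
  -- `opposite`, which leaves the pairs that avoid column 0.
  pair-sum-split : ∀ {m} (S : Fin (suc (suc m)) → Fin (suc m) → ℤ) →
    (∀ j → S (suc j) zero ≡ -1ℤ * S zero j) →
    ∑[ j < suc m ] ∑[ k < m ] S (suc j) (suc k) ≡ 0ℤ →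
    ∑[ j < suc (suc m) ] ∑[ k < suc m ] S j k ≡ 0ℤ
  pair-sum-split {m} S opposite rest≡0 = begin
    sum (S zero) + ∑[ j < suc m ] (S (suc j) zero + rest j)
      ≡⟨ cong (sum (S zero) +_) (∑-distrib-+ (λ j → S (suc j) zero) rest) ⟩
    sum (S zero) + (∑[ j < suc m ] S (suc j) zero + sum rest)
      ≡⟨ cong₂ (λ a b → sum (S zero) + (a + b)) (sum-cong-≗ opposite) rest≡0 ⟩
    sum (S zero) + (∑[ j < suc m ] (-1ℤ * S zero j) + 0ℤ)
      ≡⟨ cong (λ a → sum (S zero) + (a + 0ℤ)) (sym (*-distribˡ-sum -1ℤ (S zero))) ⟩
    sum (S zero) + (-1ℤ * sum (S zero) + 0ℤ)
      ≡⟨ cancel (sum (S zero)) ⟩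
    0ℤ ∎
    where
    rest : Fin (suc m) → ℤ
    rest j = ∑[ k < m ] S (suc j) (suc k)
    cancel : ∀ a → a + (-1ℤ * a + 0ℤ) ≡ 0ℤ
    cancel = solve-∀

  -- The terms (j , k) and (j′ , k′) that name the same two columns in opposite
  -- orders cancel; those involving column 0 are split off, and the rest is the
  -- same sum with one column fewer.
  signed-pair-sum : ∀ {p} (w : Fin (suc (suc p)) → Fin (suc (suc p)) → ℤ)
    (H : (Fin p → Fin (suc (suc p))) → ℤ)
    (S : Fin (suc (suc p)) → Fin (suc p) → ℤ) →
    (∀ j k → w j k ≡ w k j) →
    (∀ {σ τ} → (∀ l → σ l ≡ τ l) → H σ ≡ H τ) →
    (∀ j k → S j k ≡
      -1ℤ ^ toℕ j * -1ℤ ^ toℕ k * (w j (punchIn j k) * H (punchIn j ∘ punchIn k))) →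
    ∑[ j < suc (suc p) ] ∑[ k < suc p ] S j k ≡ 0ℤ
  signed-pair-sum {p} w H S w-sym H-cong S≡ = pair-sum-split S opposite (rest p w H S w-sym H-cong S≡)
    where
    move : ∀ a b x → a * b * 1ℤ * x ≡ a * (1ℤ * b * x)
    move = solve-∀
    opposite : ∀ j → S (suc j) zero ≡ -1ℤ * S zero j
    opposite j = begin
      S (suc j) zero
        ≡⟨ S≡ (suc j) zero ⟩
      -1ℤ * -1ℤ ^ toℕ j * 1ℤ * (w (suc j) zero * H (punchIn (suc j) ∘ suc))
        ≡⟨ cong (λ a → -1ℤ * -1ℤ ^ toℕ j * 1ℤ * (a * H (punchIn (suc j) ∘ suc))) (w-sym (suc j) zero) ⟩
      -1ℤ * -1ℤ ^ toℕ j * 1ℤ * (w zero (suc j) * H (punchIn (suc j) ∘ suc))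
        ≡⟨ move -1ℤ (-1ℤ ^ toℕ j) (w zero (suc j) * H (punchIn (suc j) ∘ suc)) ⟩
      -1ℤ * (1ℤ * -1ℤ ^ toℕ j * (w zero (suc j) * H (suc ∘ punchIn j)))
        ≡⟨ cong (-1ℤ *_) (sym (S≡ zero j)) ⟩
      -1ℤ * S zero j ∎
    signs : ∀ a b x → -1ℤ * a * (-1ℤ * b) * x ≡ a * b * x
    signs = solve-∀
    rest : ∀ p (w : Fin (suc (suc p)) → Fin (suc (suc p)) → ℤ)
      (H : (Fin p → Fin (suc (suc p))) → ℤ)
      (S : Fin (suc (suc p)) → Fin (suc p) → ℤ) →
      (∀ j k → w j k ≡ w k j) →
      (∀ {σ τ} → (∀ l → σ l ≡ τ l) → H σ ≡ H τ) →
      (∀ j k → S j k ≡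
        -1ℤ ^ toℕ j * -1ℤ ^ toℕ k * (w j (punchIn j k) * H (punchIn j ∘ punchIn k))) →
      ∑[ j < suc p ] ∑[ k < p ] S (suc j) (suc k) ≡ 0ℤ
    rest zero    w H S w-sym H-cong S≡ = refl
    -- None of the remaining pairs uses column 0, so every minor keeps it; `lift 1` puts it back in
    -- front of a selection from the other columns.
    rest (suc p) w H S w-sym H-cong S≡ = signed-pair-sum
      (λ j k → w (suc j) (suc k)) (H ∘ lift 1) (λ j k → S (suc j) (suc k))
      (λ j k → w-sym (suc j) (suc k))
      (λ σ≡τ → H-cong λ { zero → refl ; (suc l) → cong suc (σ≡τ l) })
      (λ j k → trans (S≡ (suc j) (suc k)) (trans
        (signs (-1ℤ ^ toℕ j) (-1ℤ ^ toℕ k)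
          (w (suc j) (suc (punchIn j k)) * H (punchIn (suc j) ∘ punchIn (suc k))))
        (cong (λ h → -1ℤ ^ toℕ j * -1ℤ ^ toℕ k * (w (suc j) (suc (punchIn j k)) * h))
          (H-cong λ { zero → refl ; (suc l) → refl }))))

  -- Expanding both determinants along two rows pairs the same minors `H` with the same signs, the
  -- sign depending on the ordered pair of columns. The sum of the two has the weight
  -- `x j * y k + y j * x k`, which is symmetric in the columns, so `signed-pair-sum` applies.
  det-swap : ∀ {m} (x y : Vector ℤ (suc (suc m))) (R : Fin m → Vector ℤ (suc (suc m))) →
             det (x ∷ y ∷ R) + det (y ∷ x ∷ R) ≡ 0ℤ
  det-swap {m} x y R = begin
    det (x ∷ y ∷ R) + det (y ∷ x ∷ R)
      ≡⟨ sym (∑-distrib-+ (term x y) (term y x)) ⟩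
    ∑[ j < suc (suc m) ] (term x y j + term y x j)
      ≡⟨ sum-cong-≗ (λ j → cong₂ _+_
           (*-distribˡ-sum (ε j * x j) (inner y j)) (*-distribˡ-sum (ε j * y j) (inner x j))) ⟩
    ∑[ j < suc (suc m) ] (∑[ k < suc m ] (ε j * x j * inner y j k) +
                          ∑[ k < suc m ] (ε j * y j * inner x j k))
      ≡⟨ sum-cong-≗ (λ j → sym
           (∑-distrib-+ (λ k → ε j * x j * inner y j k) (λ k → ε j * y j * inner x j k))) ⟩
    ∑[ j < suc (suc m) ] ∑[ k < suc m ] (ε j * x j * inner y j k + ε j * y j * inner x j k)
      ≡⟨ signed-pair-sum (λ j k → x j * y k + y j * x k) H
           (λ j k → ε j * x j * inner y j k + ε j * y j * inner x j k)
           (λ j k → w-sym (x j) (y k) (y j) (x k))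
           (λ {σ} {τ} σ≡τ → det-cong (λ i l → R i (σ l)) (λ i l → R i (τ l))
             λ i l → cong (R i) (σ≡τ l))
           (λ j k → collect (ε j) (ε k) (x j) (y j) (x (punchIn j k)) (y (punchIn j k))
             (H (punchIn j ∘ punchIn k))) ⟩
    0ℤ ∎
    where
    ε : ∀ {n} → Fin n → ℤ
    ε i = -1ℤ ^ toℕ i
    H : (Fin m → Fin (suc (suc m))) → ℤ
    H σ = det λ i l → R i (σ l)
    inner : Vector ℤ (suc (suc m)) → Fin (suc (suc m)) → Fin (suc m) → ℤ
    inner z j k = ε k * z (punchIn j k) * H (punchIn j ∘ punchIn k)
    term : Vector ℤ (suc (suc m)) → Vector ℤ (suc (suc m)) → Fin (suc (suc m)) → ℤ
    term u v j = ε j * u j * sum (inner v j)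
    w-sym : ∀ a b c d → a * b + c * d ≡ d * c + b * a
    w-sym = solve-∀
    collect : ∀ a b x y x′ y′ h →
      a * x * (b * y′ * h) + a * y * (b * x′ * h) ≡ a * b * ((x * y′ + y * x′) * h)
    collect = solve-∀

  det-repeat : ∀ {m} (x : Vector ℤ (suc (suc m))) (R : Fin m → Vector ℤ (suc (suc m))) →
               det (x ∷ x ∷ R) ≡ 0ℤ
  det-repeat x R = i+i≡0⇒i≡0 (det (x ∷ x ∷ R)) (det-swap x x R)
    where
    i+i≡0⇒i≡0 : ∀ i → i + i ≡ 0ℤ → i ≡ 0ℤ
    -- The double of any other integer computes to a nonzero constructor, so the remaining cases are
    -- absurd.
    i+i≡0⇒i≡0 (ℤ.+ zero) _ = refl

  -- Row operations and unitriangular factors.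

  -- Row 1 is the first row of each minor in the expansion along row 0, so two nested expansions
  -- make the linearity visible.
  det-row₁-linear : ∀ {m} (x y z : Vector ℤ (suc (suc m))) c (R : Fin m → Vector ℤ (suc (suc m))) →
    det (x ∷ (λ j → y j + c * z j) ∷ R) ≡ det (x ∷ y ∷ R) + c * det (x ∷ z ∷ R)
  det-row₁-linear {m} x y z c R = trans
    (sum-cong-≗ λ j → trans
      (cong (ε j * x j *_) (trans
        (sum-cong-≗ λ k → expand (ε k) (y (punchIn j k)) c (z (punchIn j k)) (H j k))
        (sum-linear c (inner y j) (inner z j))))
      (distribute (ε j * x j) (sum (inner y j)) c (sum (inner z j))))
    (sum-linear c (λ j → ε j * x j * sum (inner y j)) (λ j → ε j * x j * sum (inner z j)))
    where
    ε : ∀ {n} → Fin n → ℤ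
    ε i = -1ℤ ^ toℕ i
    H : Fin (suc (suc m)) → Fin (suc m) → ℤ
    H j k = det λ i l → R i (punchIn j (punchIn k l))
    inner : Vector ℤ (suc (suc m)) → Fin (suc (suc m)) → Fin (suc m) → ℤ
    inner u j k = ε k * u (punchIn j k) * H j k
    expand : ∀ a y c z h → a * (y + c * z) * h ≡ a * y * h + c * (a * z * h)
    expand = solve-∀
    distribute : ∀ a s c t → a * (s + c * t) ≡ a * s + c * (a * t)
    distribute = solve-∀

  -- The first of the other rows is cleared by linearity, since the repeated row
  -- contributes nothing; after it is swapped to the top, the remaining ones are
  -- cleared in each minor.
  det-add-first-row : ∀ {m} (x : Vector ℤ (suc m)) (c : Vector ℤ m) (R : Fin m → Vector ℤ (suc m)) →
    det (x ∷ (λ i j → R i j + c i * x j)) ≡ det (x ∷ R)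
  det-add-first-row {zero}  x c R = det-cong (x ∷ λ ()) (x ∷ R) λ { zero j → refl }
  det-add-first-row {suc m} x c R = begin
    det (x ∷ R′)
      ≡⟨ det-cong (x ∷ R′) (x ∷ (λ j → y j + c zero * x j) ∷ tail R′)
           (λ { zero j → refl ; (suc zero) j → refl ; (suc (suc i)) j → refl }) ⟩
    det (x ∷ (λ j → y j + c zero * x j) ∷ tail R′)
      ≡⟨ det-row₁-linear x y x (c zero) (tail R′) ⟩
    det (x ∷ y ∷ tail R′) + c zero * det (x ∷ x ∷ tail R′)
      ≡⟨ cong (λ d → det (x ∷ y ∷ tail R′) + c zero * d) (det-repeat x (tail R′)) ⟩
    det (x ∷ y ∷ tail R′) + c zero * 0ℤ
      ≡⟨ cong (λ d → det (x ∷ y ∷ tail R′) + d) (*-zeroʳ (c zero)) ⟩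
    det (x ∷ y ∷ tail R′) + 0ℤ
      ≡⟨ +-identityʳ (det (x ∷ y ∷ tail R′)) ⟩
    det (x ∷ y ∷ tail R′)
      ≡⟨ +-cancelʳ (det (y ∷ x ∷ tail R)) (det (x ∷ y ∷ tail R′)) (det (x ∷ y ∷ tail R)) (begin
           det (x ∷ y ∷ tail R′) + det (y ∷ x ∷ tail R)
             ≡⟨ cong (det (x ∷ y ∷ tail R′) +_) (sym minors) ⟩
           det (x ∷ y ∷ tail R′) + det (y ∷ x ∷ tail R′)
             ≡⟨ det-swap x y (tail R′) ⟩
           0ℤ
             ≡⟨ sym (det-swap x y (tail R)) ⟩
           det (x ∷ y ∷ tail R) + det (y ∷ x ∷ tail R) ∎) ⟩
    det (x ∷ y ∷ tail R)
      ≡⟨ det-cong (x ∷ y ∷ tail R) (x ∷ R)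
           (λ { zero j → refl ; (suc zero) j → refl ; (suc (suc i)) j → refl }) ⟩
    det (x ∷ R) ∎
    where
    y = R zero
    R′ : Fin (suc m) → Vector ℤ (suc (suc m))
    R′ i j = R i j + c i * x j
    minors : det (y ∷ x ∷ tail R′) ≡ det (y ∷ x ∷ tail R)
    minors = sum-cong-≗ λ j → cong (-1ℤ ^ toℕ j * y j *_) (begin
      det (λ i k → (x ∷ tail R′) i (punchIn j k))
        ≡⟨ det-cong (λ i k → (x ∷ tail R′) i (punchIn j k))
             ((x ∘ punchIn j) ∷ λ i k → R′ (suc i) (punchIn j k))
             (λ { zero k → refl ; (suc i) k → refl }) ⟩
      det ((x ∘ punchIn j) ∷ λ i k → R′ (suc i) (punchIn j k))
        ≡⟨ det-add-first-row (x ∘ punchIn j) (c ∘ suc) (λ i k → R (suc i) (punchIn j k)) ⟩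
      det ((x ∘ punchIn j) ∷ λ i k → R (suc i) (punchIn j k))
        ≡⟨ det-cong ((x ∘ punchIn j) ∷ λ i k → R (suc i) (punchIn j k))
             (λ i k → (x ∷ tail R) i (punchIn j k))
             (λ { zero k → refl ; (suc i) k → refl }) ⟩
      det (λ i k → (x ∷ tail R) i (punchIn j k)) ∎)

  UnitLower : ∀ {m} → SquareMatrix m → Set
  UnitLower L = (∀ i → L i i ≡ 1ℤ) × (∀ {i j} → i Fin.< j → L i j ≡ 0ℤ)

  -- The product has the same row 0 as `M`. Each later row is a multiple of that row plus a row of
  -- the product formed by the lower right block of `L` and the later rows of `M`. The multiples are
  -- removed by `det-add-first-row`, and the block is removed by induction inside each minor.
  det-unitLower-* : ∀ {m} {L : SquareMatrix m} → UnitLower L → (M : SquareMatrix m) →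
                    det (λ i j → ∑[ k < m ] (L i k * M k j)) ≡ det M
  det-unitLower-* {zero}      lower M = refl
  det-unitLower-* {suc m} {L} (diagonal , above) M = begin
    det (λ i j → ∑[ k < suc m ] (L i k * M k j))
      ≡⟨ det-cong (λ i j → ∑[ k < suc m ] (L i k * M k j))
           (M zero ∷ (λ i j → R i j + L (suc i) zero * M zero j))
           (λ { zero j → row₀ j ; (suc i) j → commute (L (suc i) zero * M zero j) (R i j) }) ⟩
    det (M zero ∷ (λ i j → R i j + L (suc i) zero * M zero j))
      ≡⟨ det-add-first-row (M zero) (λ i → L (suc i) zero) R ⟩
    det (M zero ∷ R)
      ≡⟨ sum-cong-≗ (λ j → cong (-1ℤ ^ toℕ j * M zero j *_)
           (det-unitLower-* ((diagonal ∘ suc) , λ i<j → above (ℕ.s<s i<j))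
             (λ i k → M (suc i) (punchIn j k)))) ⟩
    det M ∎
    where
    R : Fin m → Vector ℤ (suc m)
    R i j = ∑[ k < m ] (L (suc i) (suc k) * M (suc k) j)
    commute : ∀ a b → a + b ≡ b + a
    commute = solve-∀
    row₀ : ∀ j → ∑[ k < suc m ] (L zero k * M k j) ≡ M zero j
    row₀ j = begin
      L zero zero * M zero j + ∑[ k < m ] (L zero (suc k) * M (suc k) j)
        ≡⟨ cong₂ _+_ (cong (_* M zero j) (diagonal zero))
             (sum-zero λ k → cong (_* M (suc k) j) (above {zero} {suc k} ℕ.z<s)) ⟩
      1ℤ * M zero j + 0ℤ
        ≡⟨ trans (+-identityʳ (1ℤ * M zero j)) (*-identityˡ (M zero j)) ⟩
      M zero j ∎

  -- Unitriangular operators on sequences.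

  -- `Φ` keeps whatever form is convenient, while `L` is its matrix. Since `represents` allows every
  -- bound `n` above `i`, the leading block of order `n + 1` of the transformed matrix is the
  -- product of the leading blocks of `L` and `M`, so the operator preserves all leading minors at
  -- once.
  record UnitriangularOperator (Φ : Sequence → Sequence) : Set where
    field
      L          : Matrix∞
      diagonal   : ∀ i → L i i ≡ 1ℤ
      above      : ∀ {i j} → i ℕ.< j → L i j ≡ 0ℤ
      represents : ∀ n f i → i ℕ.≤ n → ∑[ k ≤ n ] (L i (toℕ k) * f (toℕ k)) ≡ Φ f i

    rows-equimodular : ∀ M → Equimodular (λ i j → Φ (λ k → M k j) i) M
    rows-equimodular M n = trans
      (det-cong (leading n (λ i j → Φ (λ k → M k j) i))
        (λ i j → ∑[ k ≤ n ] (L (toℕ i) (toℕ k) * M (toℕ k) (toℕ j)))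
        λ i j → sym (represents n (λ k → M k (toℕ j)) (toℕ i) (ℕ.s≤s⁻¹ (Fin.toℕ<n i))))
      (det-unitLower-* {L = leading n L} ((λ i → diagonal (toℕ i)) , above) (leading n M))

    columns-equimodular : ∀ M → Equimodular (λ i j → Φ (M i) j) M
    columns-equimodular M n = begin
      det (leading n (λ i j → Φ (M i) j))
        ≡⟨ det-transpose (leading n (λ i j → Φ (M i) j)) ⟨
      det (leading n (λ i j → Φ (M j) i))
        ≡⟨ rows-equimodular (λ i j → M j i) n ⟩
      det (leading n (λ i j → M j i))
        ≡⟨ det-transpose (leading n M) ⟩
      det (leading n M) ∎

  open UnitriangularOperator

  -- The binomial transform.

  sum-vanishing-tail : ∀ {m n} (f : Sequence) → m ℕ.≤ n → (∀ k → m ℕ.≤ k → f k ≡ 0ℤ) →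
                       ∑[ k < n ] f (toℕ k) ≡ ∑[ k < m ] f (toℕ k)
  sum-vanishing-tail {n = n} f z≤n f≡0 = sum-zero {n} λ k → f≡0 (toℕ k) z≤n
  sum-vanishing-tail f (s≤s m≤n)   f≡0 =
    cong (f 0 +_) (sum-vanishing-tail (f ∘ suc) m≤n λ k m≤k → f≡0 (suc k) (s≤s m≤k))

  binomial-above : ∀ {i j} → i ℕ.< j → ℤ.+ (i C j) ≡ 0ℤ
  binomial-above i<j = cong ℤ.+_ (k>n⇒nCk≡0 i<j)

  binomialTransform-truncate : ∀ n f i → i ℕ.≤ n →
    ∑[ k ≤ n ] (ℤ.+ (i C toℕ k) * f (toℕ k)) ≡ binomialTransform f i
  binomialTransform-truncate n f i i≤n =
    sum-vanishing-tail (λ k → ℤ.+ (i C k) * f k) (s≤s i≤n)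
      λ k i<k → cong (_* f k) (binomial-above i<k)

  binomialTransform-unitriangular : UnitriangularOperator binomialTransform
  binomialTransform-unitriangular = record
    { L          = λ i k → ℤ.+ (i C k)
    ; diagonal   = λ i → cong ℤ.+_ (nCn≡1 i)
    ; above      = binomial-above
    ; represents = binomialTransform-truncate
    }

  binomialTransform-zero : ∀ f → binomialTransform f 0 ≡ f 0
  binomialTransform-zero f = trans (+-identityʳ (1ℤ * f 0)) (*-identityˡ (f 0))

  binomialTransform-cong : ∀ {f g} → (∀ k → f k ≡ g k) → ∀ i →
                           binomialTransform f i ≡ binomialTransform g i
  binomialTransform-cong f≡g i =
    sum-cong-≗ {suc i} λ k → cong (ℤ.+ (i C toℕ k) *_) (f≡g (toℕ k))

  binomialTransform-linear : ∀ c f g i → binomialTransform (λ k → f k + c * g k) i ≡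
                             binomialTransform f i + c * binomialTransform g i
  binomialTransform-linear c f g i = trans
    (sum-cong-≗ {suc i} λ k → distribute (ℤ.+ (i C toℕ k)) (f (toℕ k)) c (g (toℕ k)))
    (sum-linear {suc i} c (λ k → ℤ.+ (i C toℕ k) * f (toℕ k)) (λ k → ℤ.+ (i C toℕ k) * g (toℕ k)))
    where
    distribute : ∀ a x c y → a * (x + c * y) ≡ a * x + c * (a * y)
    distribute = solve-∀

  -- Pascal's rule in operator form: a shift of the transform is the transform of identity plus
  -- shift. The recurrences of 7-matrices, Pascal triangles and Fibonacci numbers are all matched
  -- against this identity.
  binomialTransform-suc : ∀ f i → binomialTransform f (suc i) ≡
                          binomialTransform f i + binomialTransform (f ∘ suc) i
  binomialTransform-suc f i = begin
    binomialTransform f (suc i)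
      ≡⟨ cong (1ℤ * f 0 +_) (trans
           (sum-cong-≗ {suc i} λ k → pascal-rule (toℕ k))
           (∑-distrib-+ {suc i} (λ k → term (suc (toℕ k))) (λ k → ℤ.+ (i C toℕ k) * f (suc (toℕ k))))) ⟩
    1ℤ * f 0 + (∑[ k ≤ i ] term (suc (toℕ k)) + binomialTransform (f ∘ suc) i)
      ≡⟨ +-assoc (1ℤ * f 0) (∑[ k ≤ i ] term (suc (toℕ k))) (binomialTransform (f ∘ suc) i) ⟨
    ∑[ k ≤ suc i ] term (toℕ k) + binomialTransform (f ∘ suc) i
      -- The left sum runs one index too far; its extra coefficient `i C suc i` is zero.
      ≡⟨ cong (_+ binomialTransform (f ∘ suc) i) (binomialTransform-truncate (suc i) f i (ℕ.n≤1+n i)) ⟩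
    binomialTransform f i + binomialTransform (f ∘ suc) i ∎
    where
    term : Sequence
    term k = ℤ.+ (i C k) * f k
    pascal-rule : ∀ k → ℤ.+ (suc i C suc k) * f (suc k) ≡ term (suc k) + ℤ.+ (i C k) * f (suc k)
    pascal-rule k = begin
      ℤ.+ (suc i C suc k) * f (suc k)
        ≡⟨ cong (λ a → ℤ.+ a * f (suc k)) (nCk+nC[k+1]≡[n+1]C[k+1] i k) ⟨
      ℤ.+ (i C k ℕ.+ i C suc k) * f (suc k)
        ≡⟨ cong (_* f (suc k)) (pos-+ (i C k) (i C suc k)) ⟩
      (ℤ.+ (i C k) + ℤ.+ (i C suc k)) * f (suc k)
        ≡⟨ distribute (ℤ.+ (i C k)) (ℤ.+ (i C suc k)) (f (suc k)) ⟩
      term (suc k) + ℤ.+ (i C k) * f (suc k) ∎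
      where
      distribute : ∀ a b x → (a + b) * x ≡ b * x + a * x
      distribute = solve-∀

  -- From Pascal triangles and 7-matrices to Toeplitz matrices.

  -- Column `suc j` of a Toeplitz matrix without its top entry is column `j`. Hence
  -- `binomialTransform-suc`, applied to column `suc j`, is exactly the recurrence of the 7-matrix.
  sevenMatrix-binomial : ∀ a b → a 0 ≡ b 0 → ∀ i j →
    sevenMatrix (binomialTransform a) b i j ≡ binomialTransform (λ k → toeplitz a b k j) i
  sevenMatrix-binomial a b eq zero    j    = sym (binomialTransform-zero (λ k → toeplitz a b k j))
  sevenMatrix-binomial a b eq (suc i) zero =
    binomialTransform-cong (λ k → sym (toeplitz-column a b eq k)) (suc i)
  sevenMatrix-binomial a b eq (suc i) (suc j) = begin
    sevenMatrix (binomialTransform a) b i j + sevenMatrix (binomialTransform a) b i (suc j)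
      ≡⟨ cong₂ _+_ (sevenMatrix-binomial a b eq i j) (sevenMatrix-binomial a b eq i (suc j)) ⟩
    binomialTransform (λ k → toeplitz a b k j) i + binomialTransform (λ k → toeplitz a b k (suc j)) i
      ≡⟨ +-comm (binomialTransform (λ k → toeplitz a b k j) i)
           (binomialTransform (λ k → toeplitz a b k (suc j)) i) ⟩
    binomialTransform (λ k → toeplitz a b k (suc j)) i + binomialTransform (λ k → toeplitz a b k j) i
      ≡⟨ binomialTransform-suc (λ k → toeplitz a b k (suc j)) i ⟨
    binomialTransform (λ k → toeplitz a b k (suc j)) (suc i) ∎

  -- By the recurrence of the 7-matrix, the shift of row `suc i` is row `i` plus its own shift, so
  -- its transform at `j` is that of row `i` at `suc j`. One more use of `binomialTransform-suc`, on
  -- row `suc i`, gives the recurrence of the Pascal triangle.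
  pascal-binomial : ∀ a b i j →
    pascal a (binomialTransform b) i j ≡ binomialTransform (sevenMatrix a b i) j
  pascal-binomial a b zero    j       = refl
  pascal-binomial a b (suc i) zero    = sym (binomialTransform-zero (sevenMatrix a b (suc i)))
  pascal-binomial a b (suc i) (suc j) = begin
    pascal a (binomialTransform b) (suc i) j + pascal a (binomialTransform b) i (suc j)
      ≡⟨ cong₂ _+_ (pascal-binomial a b (suc i) j) (pascal-binomial a b i (suc j)) ⟩
    binomialTransform (row (suc i)) j + binomialTransform (row i) (suc j)
      ≡⟨ cong (binomialTransform (row (suc i)) j +_) (begin
           binomialTransform (row i) (suc j)
             ≡⟨ binomialTransform-suc (row i) j ⟩
           binomialTransform (row i) j + binomialTransform (row i ∘ suc) j
             ≡⟨ cong (binomialTransform (row i) j +_) (*-identityˡ (binomialTransform (row i ∘ suc) j)) ⟨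
           binomialTransform (row i) j + 1ℤ * binomialTransform (row i ∘ suc) j
             ≡⟨ binomialTransform-linear 1ℤ (row i) (row i ∘ suc) j ⟨
           binomialTransform (λ k → row i k + 1ℤ * row i (suc k)) j
             ≡⟨ binomialTransform-cong (λ k → cong (row i k +_) (*-identityˡ (row i (suc k)))) j ⟩
           binomialTransform (row (suc i) ∘ suc) j ∎) ⟩
    binomialTransform (row (suc i)) j + binomialTransform (row (suc i) ∘ suc) j
      ≡⟨ binomialTransform-suc (row (suc i)) j ⟨
    binomialTransform (row (suc i)) (suc j) ∎
    where
    row : Matrix∞
    row = sevenMatrix a b

  sevenMatrix-toeplitz-equimodular : ∀ a b → a 0 ≡ b 0 →
    Equimodular (sevenMatrix (binomialTransform a) b) (toeplitz a b)
  sevenMatrix-toeplitz-equimodular a b eq n = trans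
    (det-cong (leading n (sevenMatrix (binomialTransform a) b))
      (leading n (λ i j → binomialTransform (λ k → toeplitz a b k j) i))
      λ i j → sevenMatrix-binomial a b eq (toℕ i) (toℕ j))
    (rows-equimodular binomialTransform-unitriangular (toeplitz a b) n)

  pascal-sevenMatrix-equimodular : ∀ a b →
    Equimodular (pascal a (binomialTransform b)) (sevenMatrix a b)
  pascal-sevenMatrix-equimodular a b n = trans
    (det-cong (leading n (pascal a (binomialTransform b)))
      (leading n (λ i j → binomialTransform (sevenMatrix a b i) j))
      λ i j → pascal-binomial a b (toℕ i) (toℕ j))
    (columns-equimodular binomialTransform-unitriangular (sevenMatrix a b) n)

  toeplitz-swap : ∀ a b → a 0 ≡ b 0 → ∀ i j → toeplitz a b i j ≡ toeplitz b a j i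
  toeplitz-swap a b eq zero    j       = sym (toeplitz-column b a (sym eq) j)
  toeplitz-swap a b eq (suc i) zero    = refl
  toeplitz-swap a b eq (suc i) (suc j) = toeplitz-swap a b eq i j

  toeplitz-swap-equimodular : ∀ a b → a 0 ≡ b 0 → Equimodular (toeplitz a b) (toeplitz b a)
  toeplitz-swap-equimodular a b eq n = trans
    (det-cong (leading n (toeplitz a b)) (transpose (leading n (toeplitz b a)))
      λ i j → toeplitz-swap a b eq (toℕ i) (toℕ j))
    (det-transpose (leading n (toeplitz b a)))

  -- Binomial transforms of the two Fibonacci sequences.

  -- The offset `s` is general because the induction compares `s` with `suc s`; `check-α` is the
  -- case of offset 1.
  binomialTransform-fib : ∀ i s → binomialTransform (λ k → fib (s ℕ.+ k)) i ≡ fib (s ℕ.+ 2 ℕ.* i)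
  binomialTransform-fib zero    s = binomialTransform-zero (λ k → fib (s ℕ.+ k))
  binomialTransform-fib (suc i) s = begin
    binomialTransform (λ k → fib (s ℕ.+ k)) (suc i)
      ≡⟨ binomialTransform-suc (λ k → fib (s ℕ.+ k)) i ⟩
    binomialTransform (λ k → fib (s ℕ.+ k)) i + binomialTransform (λ k → fib (s ℕ.+ suc k)) i
      ≡⟨ cong₂ _+_ (binomialTransform-fib i s) (trans
           (binomialTransform-cong (λ k → cong fib (ℕ.+-suc s k)) i)
           (binomialTransform-fib i (suc s))) ⟩
    fib (s ℕ.+ 2 ℕ.* i) + fib (suc s ℕ.+ 2 ℕ.* i)
      ≡⟨ +-comm (fib (s ℕ.+ 2 ℕ.* i)) (fib (suc s ℕ.+ 2 ℕ.* i)) ⟩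
    fib (2 ℕ.+ (s ℕ.+ 2 ℕ.* i))
      ≡⟨ cong fib (index s i) ⟩
    fib (s ℕ.+ 2 ℕ.* suc i) ∎
    where
    index : ∀ s i → 2 ℕ.+ (s ℕ.+ 2 ℕ.* i) ≡ s ℕ.+ 2 ℕ.* suc i
    index = ℕSolver.solve-∀

  fibPred-suc-suc : ∀ i → fibPred (suc (suc i)) ≡ fibPred (suc i) + fibPred i
  fibPred-suc-suc zero    = refl
  fibPred-suc-suc (suc i) = refl

  -- The alternating signs turn the Fibonacci recurrence into `α~ (k + 2) = α~ k - α~ (k + 1)`, so
  -- the transforms of `α~` and of its shift determine each other's next values and are computed
  -- together. The second is the Fibonacci number of index `i - 2`, written as a difference to avoid
  -- the index -2.
  binomialTransform-α~ : ∀ i →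
    check-α~ i ≡ fibPred i ×
    binomialTransform (α~ ∘ suc) i ≡ fibPred (suc i) - fibPred i
  binomialTransform-α~ zero    = refl , refl
  binomialTransform-α~ (suc i) = α~-case , α~-suc-case
    where
    p = proj₁ (binomialTransform-α~ i)
    q = proj₂ (binomialTransform-α~ i)
    first : ∀ x y → x + (y - x) ≡ y
    first = solve-∀
    second : ∀ x y → y - x + (x + -1ℤ * (y - x)) ≡ (y + x) - y
    second = solve-∀
    recurrence : ∀ k → α~ (suc (suc k)) ≡ α~ k + -1ℤ * α~ (suc k)
    recurrence k = signs (-1ℤ ^ k) (fib (suc k)) (fib (suc (suc k)))
      where
      signs : ∀ e a b → -1ℤ * (-1ℤ * e) * (b + a) ≡ e * a + -1ℤ * (-1ℤ * e * b)
      signs = solve-∀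
    α~-case : check-α~ (suc i) ≡ fibPred (suc i)
    α~-case = begin
      check-α~ (suc i)
        ≡⟨ binomialTransform-suc α~ i ⟩
      check-α~ i + binomialTransform (α~ ∘ suc) i
        ≡⟨ cong₂ _+_ p q ⟩
      fibPred i + (fibPred (suc i) - fibPred i)
        ≡⟨ first (fibPred i) (fibPred (suc i)) ⟩
      fibPred (suc i) ∎
    α~-suc-case : binomialTransform (α~ ∘ suc) (suc i) ≡ fibPred (suc (suc i)) - fibPred (suc i)
    α~-suc-case = begin
      binomialTransform (α~ ∘ suc) (suc i)
        ≡⟨ binomialTransform-suc (α~ ∘ suc) i ⟩
      binomialTransform (α~ ∘ suc) i + binomialTransform (λ k → α~ (suc (suc k))) i
        ≡⟨ cong (binomialTransform (α~ ∘ suc) i +_) (trans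
             (binomialTransform-cong {λ k → α~ (suc (suc k))} recurrence i)
             (binomialTransform-linear -1ℤ α~ (α~ ∘ suc) i)) ⟩
      binomialTransform (α~ ∘ suc) i + (check-α~ i + -1ℤ * binomialTransform (α~ ∘ suc) i)
        ≡⟨ cong₂ (λ x y → y + (x + -1ℤ * y)) p q ⟩
      fibPred (suc i) - fibPred i + (fibPred i + -1ℤ * (fibPred (suc i) - fibPred i))
        ≡⟨ second (fibPred i) (fibPred (suc i)) ⟩
      (fibPred (suc i) + fibPred i) - fibPred (suc i)
        ≡⟨ cong (_- fibPred (suc i)) (fibPred-suc-suc i) ⟨
      fibPred (suc (suc i)) - fibPred (suc i) ∎

  -- Reduction of the Toeplitz matrix by the Fibonacci recurrence.

  -- Multiplication of the generating function by 1 - x - x²; predecessors missing at the start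
  -- count as zero.
  fibonacciDifference : Sequence → Sequence
  fibonacciDifference f zero          = f 0
  fibonacciDifference f (suc zero)    = f 1 - f 0
  fibonacciDifference f (suc (suc i)) = f (suc (suc i)) - f (suc i) - f i

  fibonacciDifference-unitriangular : UnitriangularOperator fibonacciDifference
  fibonacciDifference-unitriangular = record
    { L = D ; diagonal = diag ; above = upper ; represents = repr }
    where
    D : Matrix∞
    D zero                zero    = 1ℤ
    D zero                (suc k) = 0ℤ
    D (suc zero)          zero    = -1ℤ
    D (suc (suc zero))    zero    = -1ℤ
    D (suc (suc (suc i))) zero    = 0ℤ
    D (suc i)             (suc k) = D i k
    -- For a variable `i` this does not hold by computation, because the clauses for column 0
    -- inspect the row index more deeply.
    D-suc : ∀ i k → D (suc i) (suc k) ≡ D i k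
    D-suc zero          k = refl
    D-suc (suc zero)    k = refl
    D-suc (suc (suc i)) k = refl
    diag : ∀ i → D i i ≡ 1ℤ
    diag zero    = refl
    diag (suc i) = trans (D-suc i i) (diag i)
    upper : ∀ {i j} → i ℕ.< j → D i j ≡ 0ℤ
    upper {zero}  {suc j} _         = refl
    upper {suc i} {suc j} (s≤s i<j) = trans (D-suc i j) (upper i<j)
    first : ∀ x → 1ℤ * x + 0ℤ ≡ x
    first = solve-∀
    second : ∀ x y → -1ℤ * x + y ≡ y - x
    second = solve-∀
    repr : ∀ n f i → i ℕ.≤ n → ∑[ k ≤ n ] (D i (toℕ k) * f (toℕ k)) ≡ fibonacciDifference f i
    repr n       f zero                _ =
      trans (cong (1ℤ * f 0 +_) (sum-zero {n} λ k → refl)) (first (f 0))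
    repr (suc n) f (suc zero)          (s≤s i≤n) =
      trans (cong (-1ℤ * f 0 +_) (repr n (f ∘ suc) 0 i≤n)) (second (f 0) (f 1))
    repr (suc n) f (suc (suc zero))    (s≤s i≤n) =
      trans (cong (-1ℤ * f 0 +_) (repr n (f ∘ suc) 1 i≤n)) (second (f 0) (f 2 - f 1))
    repr (suc n) f (suc (suc (suc i))) (s≤s i≤n) =
      trans (+-identityˡ (∑[ k ≤ n ] (D (suc (suc i)) (toℕ k) * f (suc (toℕ k)))))
        (repr n (f ∘ suc) (suc (suc i)) i≤n)

  -- Evaluation of the reduced determinant.

  δ : Matrix∞
  δ zero    zero    = 1ℤ
  δ zero    (suc j) = 0ℤ
  δ (suc i) zero    = 0ℤ
  δ (suc i) (suc j) = δ i j

  consColumn : Sequence → Matrix∞ → Matrix∞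
  consColumn c M i zero    = c i
  consColumn c M i (suc j) = M i j

  a*0*b≡0 : ∀ a b → a * 0ℤ * b ≡ 0ℤ
  a*0*b≡0 = solve-∀

  det-zero-column : ∀ {m} (M : SquareMatrix (suc m)) → (∀ i → M i zero ≡ 0ℤ) → det M ≡ 0ℤ
  det-zero-column {m} M column≡0 = trans (det-laplace-column M) (sum-zero λ i →
    trans (cong (λ a → -1ℤ ^ toℕ i * a * det (minor i)) (column≡0 i)) (a*0*b≡0 (-1ℤ ^ toℕ i) (det (minor i))))
    where
    minor : Fin (suc m) → SquareMatrix m
    minor i k l = M (punchIn i k) (suc l)

  -- Only the entries c 0 and 1 of the first row contribute; the minor of c 0
  -- starts with a zero column.
  det-consColumn-δ : ∀ n c → det (leading n (consColumn c δ)) ≡ -1ℤ ^ n * c n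
  det-consColumn-δ zero    c = one (c 0)
    where
    one : ∀ x → 1ℤ * x * 1ℤ + 0ℤ ≡ 1ℤ * x
    one = solve-∀
  det-consColumn-δ (suc n) c = begin
    1ℤ * c 0 * det minor₀ + (-1ℤ * 1ℤ * det minor₁ + ∑[ j < n ] tail-term j)
      ≡⟨ cong₂ (λ a b → 1ℤ * c 0 * a + b) (det-zero-column minor₀ λ i → refl)
           (cong₂ (λ a b → -1ℤ * 1ℤ * a + b)
             (trans (det-cong minor₁ (leading n (consColumn (c ∘ suc) δ)) minor₁≡) (det-consColumn-δ n (c ∘ suc)))
             (sum-zero λ j → a*0*b≡0 (-1ℤ ^ suc (suc (toℕ j))) (det (minor j)))) ⟩
    1ℤ * c 0 * 0ℤ + (-1ℤ * 1ℤ * (-1ℤ ^ n * c (suc n)) + 0ℤ)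
      ≡⟨ collect (c 0) (-1ℤ ^ n) (c (suc n)) ⟩
    -1ℤ ^ suc n * c (suc n) ∎
    where
    A = leading (suc n) (consColumn c δ)
    minor₀ minor₁ : SquareMatrix (suc n)
    minor₀ i k = A (suc i) (suc k)
    minor₁ i k = A (suc i) (punchIn (suc zero) k)
    minor : Fin n → SquareMatrix (suc n)
    minor j i k = A (suc i) (punchIn (suc (suc j)) k)
    tail-term : Fin n → ℤ
    tail-term j = -1ℤ ^ suc (suc (toℕ j)) * 0ℤ * det (minor j)
    minor₁≡ : ∀ i k → minor₁ i k ≡ leading n (consColumn (c ∘ suc) δ) i k
    minor₁≡ i zero    = refl
    minor₁≡ i (suc k) = refl
    collect : ∀ a e x → 1ℤ * a * 0ℤ + (-1ℤ * 1ℤ * (e * x) + 0ℤ) ≡ -1ℤ * e * x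
    collect = solve-∀

  reduced : Matrix∞
  reduced i = fibonacciDifference (toeplitz α~ α i)

  -- Column 1 has a single predecessor, so below row 0 it becomes `α~ i - α~ (suc i)`; the opposite
  -- signs make this a sum of consecutive Fibonacci numbers.
  reducedColumn : Sequence
  reducedColumn i = -1ℤ ^ i * fib (suc (suc (suc i)))

  -- At index 1 this is the equality of the Fibonacci numbers of index 1 and 2; afterwards it is
  -- their recurrence.
  reduced-first-row : ∀ j → reduced 0 (suc j) ≡ 0ℤ
  reduced-first-row zero    = refl
  reduced-first-row (suc j) = cancel (fib (suc (suc j))) (fib (suc j))
    where
    cancel : ∀ a b → a + b - a - b ≡ 0ℤ
    cancel = solve-∀

  -- From column 2 of `reduced` on, a row violates the Fibonacci recurrence only immediately to the
  -- right of the diagonal, where the two halves of the Toeplitz matrix meet: there the difference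
  -- is 1 - 1 - (-1) = 1, which yields `δ`. Farther right it vanishes as in the first row; on and
  -- below the diagonal it vanishes by the recurrence of `α~` read backwards.
  reduced-minor : ∀ i j → reduced (suc i) (suc j) ≡ consColumn reducedColumn δ i j
  reduced-minor i zero = begin
    toeplitz α~ α i 0 - α~ (suc i)
      ≡⟨ cong (_- α~ (suc i)) (toeplitz-column α~ α refl i) ⟩
    α~ i - α~ (suc i)
      ≡⟨ signs (-1ℤ ^ i) (fib (suc i)) (fib (suc (suc i))) ⟩
    reducedColumn i ∎
    where
    signs : ∀ e a b → e * a - -1ℤ * e * b ≡ e * (b + a)
    signs = solve-∀
  reduced-minor zero    (suc zero)    = refl
  reduced-minor zero    (suc (suc j)) = reduced-first-row (suc j)
  reduced-minor (suc i) (suc zero)    = begin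
    toeplitz α~ α i 0 - α~ (suc i) - α~ (suc (suc i))
      ≡⟨ cong (λ a → a - α~ (suc i) - α~ (suc (suc i))) (toeplitz-column α~ α refl i) ⟩
    α~ i - α~ (suc i) - α~ (suc (suc i))
      ≡⟨ signs (-1ℤ ^ i) (fib (suc i)) (fib (suc (suc i))) ⟩
    0ℤ ∎
    where
    signs : ∀ e a b → e * a - -1ℤ * e * b - -1ℤ * (-1ℤ * e) * (b + a) ≡ 0ℤ
    signs = solve-∀
  reduced-minor (suc i) (suc (suc j)) = reduced-minor i (suc j)

  -1^n*-1^n≡1 : ∀ n → -1ℤ ^ n * -1ℤ ^ n ≡ 1ℤ
  -1^n*-1^n≡1 zero    = refl
  -1^n*-1^n≡1 (suc n) = trans (signs (-1ℤ ^ n)) (-1^n*-1^n≡1 n)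
    where
    signs : ∀ e → -1ℤ * e * (-1ℤ * e) ≡ e * e
    signs = solve-∀

  det-reduced : ∀ n → det (leading n reduced) ≡ fib (suc (suc n))
  det-reduced zero    = refl
  det-reduced (suc n) = begin
    1ℤ * 1ℤ * det (minor zero) +
    ∑[ j < suc n ] (-1ℤ ^ suc (toℕ j) * reduced 0 (suc (toℕ j)) * det (minor (suc j)))
      ≡⟨ cong₂ (λ a b → 1ℤ * 1ℤ * a + b)
           (trans (det-cong (minor zero) (leading n (consColumn reducedColumn δ))
                    (λ i j → reduced-minor (toℕ i) (toℕ j)))
                  (det-consColumn-δ n reducedColumn))
           (sum-zero λ j → trans
             (cong (λ a → -1ℤ ^ suc (toℕ j) * a * det (minor (suc j))) (reduced-first-row (toℕ j)))
             (a*0*b≡0 (-1ℤ ^ suc (toℕ j)) (det (minor (suc j))))) ⟩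
    1ℤ * 1ℤ * (-1ℤ ^ n * (-1ℤ ^ n * fib (suc (suc (suc n))))) + 0ℤ
      -- One power of -1 comes from evaluating the minor, the other from the last entry of
      -- `reducedColumn`; they cancel.
      ≡⟨ regroup (-1ℤ ^ n) (fib (suc (suc (suc n)))) ⟩
    -1ℤ ^ n * -1ℤ ^ n * fib (suc (suc (suc n)))
      ≡⟨ cong (_* fib (suc (suc (suc n)))) (-1^n*-1^n≡1 n) ⟩
    1ℤ * fib (suc (suc (suc n)))
      ≡⟨ *-identityˡ (fib (suc (suc (suc n)))) ⟩
    fib (suc (suc (suc n))) ∎
    where
    minor : Fin (suc (suc n)) → SquareMatrix (suc n)
    minor j i k = reduced (toℕ (suc i)) (toℕ (punchIn j k))
    regroup : ∀ e x → 1ℤ * 1ℤ * (e * (e * x)) + 0ℤ ≡ e * e * x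
    regroup = solve-∀

  toeplitz-α~-α-minors : ∀ n → det (leading n (toeplitz α~ α)) ≡ fib (suc (suc n))
  toeplitz-α~-α-minors n = trans
    (sym (columns-equimodular fibonacciDifference-unitriangular (toeplitz α~ α) n))
    (det-reduced n)

open Determinants
open import Data.List.Base using (List; []; _∷_)
open import Data.List.Relation.Unary.All as All using (All; []; _∷_)
open import Data.List.Relation.Unary.AllPairs using (AllPairs; []; _∷_)
open import Data.Nat.Base using (ℕ; _+_; _*_)

-- The leading minors of the six matrices.

HasFibonacciMinors : Matrix∞ → Set
HasFibonacciMinors M = ∀ n → det (leading n M) ≡ fib (2 + n)

pairwise-equimodular : ∀ {Ms : List Matrix∞} → All HasFibonacciMinors Ms → AllPairs Equimodular Ms
pairwise-equimodular []           = []
pairwise-equimodular (minors ∷ rest) =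
  All.map (λ minors′ n → trans (minors n) (sym (minors′ n))) rest ∷ pairwise-equimodular rest

toeplitz-α-α~-minors : HasFibonacciMinors (toeplitz α α~)
toeplitz-α-α~-minors n =
  trans (toeplitz-swap-equimodular α α~ refl n) (toeplitz-α~-α-minors n)

sevenMatrix-α~-α-minors : HasFibonacciMinors (sevenMatrix check-α~ α)
sevenMatrix-α~-α-minors n =
  trans (sevenMatrix-toeplitz-equimodular α~ α refl n) (toeplitz-α~-α-minors n)

sevenMatrix-α-α~-minors : HasFibonacciMinors (sevenMatrix check-α α~)
sevenMatrix-α-α~-minors n =
  trans (sevenMatrix-toeplitz-equimodular α α~ refl n) (toeplitz-α-α~-minors n)

pascal-α~-α-minors : HasFibonacciMinors (pascal check-α~ check-α)
pascal-α~-α-minors n =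
  trans (pascal-sevenMatrix-equimodular check-α~ α n) (sevenMatrix-α~-α-minors n)

pascal-α-α~-minors : HasFibonacciMinors (pascal check-α check-α~)
pascal-α-α~-minors n =
  trans (pascal-sevenMatrix-equimodular check-α α~ n) (sevenMatrix-α-α~-minors n)

corollary4 : (∀ i → check-α i ≡ fib (1 + 2 * i)) ×
    (∀ i → check-α~ i ≡ fibPred i) ×
    AllPairs Equimodular
    ( toeplitz α~ α
    ∷ toeplitz α α~
    ∷ pascal check-α~ check-α
    ∷ pascal check-α check-α~
    ∷ sevenMatrix check-α~ α
    ∷ sevenMatrix check-α α~
    ∷ [] ) ×
    (∀ (n : ℕ) →
    det (leading n (toeplitz α~ α)) ≡ det (leading n (toeplitz α α~)) ×
    det (leading n (toeplitz α α~)) ≡ det (leading n (pascal check-α~ check-α)) ×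
    det (leading n (pascal check-α~ check-α)) ≡ det (leading n (pascal check-α check-α~)) ×
    det (leading n (pascal check-α check-α~)) ≡ det (leading n (sevenMatrix check-α~ α)) ×
    det (leading n (sevenMatrix check-α~ α)) ≡ det (leading n (sevenMatrix check-α α~)) ×
    det (leading n (sevenMatrix check-α α~)) ≡ fib (2 + n))
corollary4 =
  (λ i → binomialTransform-fib i 1) ,
  (λ i → proj₁ (binomialTransform-α~ i)) ,
  pairwise-equimodular
    ( toeplitz-α~-α-minors
    ∷ toeplitz-α-α~-minors
    ∷ pascal-α~-α-minors
    ∷ pascal-α-α~-minors
    ∷ sevenMatrix-α~-α-minors
    ∷ sevenMatrix-α-α~-minors
    ∷ [] ) ,
  λ n →
    trans (toeplitz-α~-α-minors n) (sym (toeplitz-α-α~-minors n)) ,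
    trans (toeplitz-α-α~-minors n) (sym (pascal-α~-α-minors n)) ,
    trans (pascal-α~-α-minors n) (sym (pascal-α-α~-minors n)) ,
    trans (pascal-α-α~-minors n) (sym (sevenMatrix-α~-α-minors n)) ,
    trans (sevenMatrix-α~-α-minors n) (sym (sevenMatrix-α-α~-minors n)) ,
    sevenMatrix-α-α~-minors n
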